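{- For any graph $G$ of order $n$ (with $n\ge 1$) and maximum degree $\Delta$, with complement $\overline{G}$, \[ \operatorname{st}_{\gamma_{st}}(G)+\operatorname{st}_{\gamma_{st}}(\overline{G})\le 2n-\frac{n}{n-\Delta}+2 . \]
   Context: All graphs are finite, simple and undirected. For a graph $G=(V,E)$, a set $D\subseteq V$ is a strong dominating set if every vertex $v\in V\setminus D$ is adjacent to some $u\in D$ with $\deg(v)\le\deg(u)$ (degrees taken in $G$). The strong domination number $\gamma_{st}(G)$ is the minimum size of a strong dominating set; the graph with no vertices has $\gamma_{st}=0$. For $S\subseteq V$, $G-S$ is the graph obtained by deleting the vertices of $S$. The stability of the strong domination number is $\operatorname{st}_{\gamma_{st}}(G)=\min\{|S| : S\subseteq V,\ \gamma_{st}(G-S)\ne\gamma_{st}(G)\}$ (the choice $S=V$ is allowed, so that $\operatorname{st}_{\gamma_{st}}(K_n)=n$). -}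

module Defs where

open import Data.Bool.Properties using (T-≡)
open import Data.Fin using (Fin; _≟_)
open import Data.Fin.Properties using (all?; any?)
open import Data.Fin.Subset using (Subset; inside; outside; _∈_; _∉_; _⊆_; _─_; ∣_∣)
open import Data.Fin.Subset.Properties using (_∈?_; _⊆?_; p⊂q⇒∣p∣<∣q∣)
open import Data.List using (List; []; _∷_; _++_; map; filter; allFin)
open import Data.List.Extrema.Nat using (min; max; max<v⁺)
import Data.List.Relation.Unary.All as All
import Data.List.Relation.Unary.All.Properties as All
open import Data.Nat using (ℕ; zero; suc; _∸_; _<_; _≤_; _≤?_; NonZero; >-nonZero; >-nonZero⁻¹)
import Data.Nat as ℕ
open import Data.Nat.Properties using (m<n⇒0<n∸m)
open import Data.Product using (∃; _×_; _,_; proj₁; proj₂)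
open import Data.Vec using ([]; _∷_; tabulate)
open import Data.Vec.Properties using ([]=⇒lookup; lookup∘tabulate)
open import Function.Bundles using (Equivalence)
open import Level using (0ℓ)
open import Relation.Binary using (Rel; Symmetric; Irreflexive) renaming (Decidable to Decidable₂)
open import Relation.Binary.PropositionalEquality using (_≡_; _≢_; refl; sym; trans; ≢-sym)
open import Relation.Nullary using (¬_; does; ¬?; _×-dec_; _→-dec_)
open import Relation.Nullary.Decidable using (isYes≗does; toWitness)
open import Relation.Unary using (Decidable)

-- The vertex set is a subset V of an ambient Fin N, so that deleting vertices
-- needs no relabelling; every graph on n labelled vertices is the case V = ⊤
-- of N = n.

record Graph (N : ℕ) : Set₁ where
  field
    V      : Subset N
    Adj    : Rel (Fin N) 0ℓ
    Adj?   : Decidable₂ Adj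
    symm   : Symmetric Adj
    irrefl : Irreflexive _≡_ Adj
    Adj⇒∈V : ∀ {u v} → Adj u v → u ∈ V

open Graph public

private
  variable
    N : ℕ

order : Graph N → ℕ
order G = ∣ V G ∣

neighbours : Graph N → Fin N → Subset N
neighbours G v = tabulate (λ u → does (Adj? G v u))

deg : Graph N → Fin N → ℕ
deg G v = ∣ neighbours G v ∣

maxDegree : Graph N → ℕ
maxDegree {N} G = max 0 (map (deg G) (filter (_∈? V G) (allFin N)))

complement : Graph N → Graph N
complement G = record
  { V      = V G
  ; Adj    = λ u v → u ∈ V G × v ∈ V G × u ≢ v × ¬ Adj G u v
  ; Adj?   = λ u v → (u ∈? V G) ×-dec (v ∈? V G) ×-dec ¬? (u ≟ v) ×-dec ¬? (Adj? G u v)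
  ; symm   = λ (u∈V , v∈V , u≢v , ¬uv) → v∈V , u∈V , ≢-sym u≢v , λ vu → ¬uv (symm G vu)
  ; irrefl = λ u≡v (_ , _ , u≢v , _) → u≢v u≡v
  ; Adj⇒∈V = proj₁
  }

delete : Graph N → Subset N → Graph N
delete G S = record
  { V      = V G ─ S
  ; Adj    = λ u v → u ∈ V G ─ S × v ∈ V G ─ S × Adj G u v
  ; Adj?   = λ u v → (u ∈? V G ─ S) ×-dec (v ∈? V G ─ S) ×-dec Adj? G u v
  ; symm   = λ (u∈ , v∈ , uv) → v∈ , u∈ , symm G uv
  ; irrefl = λ u≡v (_ , _ , uv) → irrefl G u≡v uv
  ; Adj⇒∈V = proj₁
  }

StrongDominating : Graph N → Subset N → Set
StrongDominating G D =
  D ⊆ V G ×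
  (∀ v → v ∈ V G → v ∉ D → ∃ λ u → u ∈ D × Adj G v u × deg G v ≤ deg G u)

strongDominating? : (G : Graph N) → Decidable (StrongDominating G)
strongDominating? G D =
  (D ⊆? V G) ×-dec
  all? (λ v → (v ∈? V G) →-dec (¬? (v ∈? D) →-dec
    any? (λ u → (u ∈? D) ×-dec Adj? G v u ×-dec (deg G v ≤? deg G u))))

subsets : ∀ N → List (Subset N)
subsets zero    = [] ∷ []
subsets (suc N) = map (outside ∷_) (subsets N) ++ map (inside ∷_) (subsets N)

-- min ⊤ xs is the least element of ⊤ ∷ xs. The extra value order G does not
-- affect the minimum, because V G itself is a strong dominating set.

γst : Graph N → ℕ
γst {N} G = min (order G) (map ∣_∣ (filter (strongDominating? G) (subsets N)))

Changes-γst : Graph N → Subset N → Set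
Changes-γst G S = S ⊆ V G × γst (delete G S) ≢ γst G

changes-γst? : (G : Graph N) → Decidable (Changes-γst G)
changes-γst? G S = (S ⊆? V G) ×-dec ¬? (γst (delete G S) ℕ.≟ γst G)

-- For a graph with at least one vertex the extra value order G is again
-- attained, by S = V G: then γst (delete G S) is 0 and γst G is not. (For the
-- graph with no vertices no S changes γst, and the value here is 0.)

st-γst : Graph N → ℕ
st-γst {N} G = min (order G) (map ∣_∣ (filter (changes-γst? G) (subsets N)))

∈-neighbours⁻ : (G : Graph N) {v u : Fin N} → u ∈ neighbours G v → Adj G v u
∈-neighbours⁻ G {v} {u} u∈ =
  toWitness {a? = Adj? G v u} (Equivalence.from T-≡ (trans (isYes≗does (Adj? G v u)) (trans (sym (lookup∘tabulate _ u)) ([]=⇒lookup u∈))))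

deg<order : (G : Graph N) {v : Fin N} → v ∈ V G → deg G v < order G
deg<order G {v} v∈V = p⊂q⇒∣p∣<∣q∣
  ( (λ u∈ → Adj⇒∈V G (symm G (∈-neighbours⁻ G u∈)))
  , v , v∈V , λ v∈ → irrefl G refl (∈-neighbours⁻ G v∈) )

maxDegree<order : (G : Graph N) → .{{NonZero (order G)}} → maxDegree G < order G
maxDegree<order {N} G = max<v⁺ (>-nonZero⁻¹ (order G))
  (All.map⁺ (All.map (deg<order G) (All.all-filter (_∈? V G) (allFin N))))

order∸maxDegree≢0 : (G : Graph N) → .{{NonZero (order G)}} → NonZero (order G ∸ maxDegree G)
order∸maxDegree≢0 G = >-nonZero (m<n⇒0<n∸m (maxDegree<order G))

{-# OPTIONS --safe #-}

-- st-γst G ≤ n trivially, so the bound reduces to st-γst (complement G) ≤ n ∸ Δ,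
-- since m + n / m ≤ n + 2 for m = n ∸ Δ between 1 and n. To see this, let v be
-- any vertex and let S be its closed neighbourhood in the complement, so that
-- ∣ S ∣ = n ∸ deg G v. Deleting S - v leaves v isolated, and then deleting v
-- as well strictly decreases γst; hence at least one of S - v and S changes γst.

module Submission where

open import Defs
open import Data.Fin using (Fin)
open import Data.Fin.Subset using (Subset; inside; outside; _∈_; _∉_; _⊆_; _─_; ∣_∣)
  renaming (_-_ to _∖_)
open import Data.Fin.Subset.Properties
  using (_∈?_; drop-∷-⊆; p─q⊆p; x∈p∧x∉q⇒x∈p─q; x∈p∧x≢y⇒x∈p-y; x∈p⇒∣p-x∣<∣p∣; p⊆q⇒∣p∣≤∣q∣; x∈⁅x⁆)
open import Data.Integer using (+_)
import Data.Integer as ℤ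
import Data.Integer.Properties as ℤ
import Data.Integer.Tactic.RingSolver as ℤ-RingSolver
open import Data.List using (map; filter; allFin)
open import Data.List.Extrema.Nat using (min; min≤⊤; min≤v⁺; max≤v⁺; argmin-sel)
open import Data.List.Membership.Propositional using (lose) renaming (_∈_ to _∈ˡ_)
open import Data.List.Membership.Propositional.Properties
  using (∈-map⁺; ∈-map⁻; ∈-filter⁺; ∈-filter⁻; ∈-++⁺ˡ; ∈-++⁺ʳ)
import Data.List.Relation.Unary.All as All
import Data.List.Relation.Unary.All.Properties as All
open import Data.List.Relation.Unary.Any using (here)
open import Data.Nat using (ℕ; suc; NonZero; _∸_)
import Data.Nat as ℕ
import Data.Nat.Properties as ℕ
open import Data.Nat.Tactic.RingSolver using (solve-∀)
open import Data.Product using (∃; _×_; _,_)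
open import Data.Rational using (_≤_; _+_; _-_; _/_; toℚᵘ)
import Data.Rational as ℚ
import Data.Rational.Properties as ℚ
open import Data.Rational.Unnormalised using (mkℚᵘ; *≤*)
import Data.Rational.Unnormalised as ℚᵘ
import Data.Rational.Unnormalised.Properties as ℚᵘ
open import Data.Sum using (inj₁; inj₂)
open import Data.Vec using ([]; _∷_)
import Data.Vec as Vec
open import Data.Vec.Properties using (lookup∘tabulate; lookup⇒[]=; tabulate-cong)
open import Function using (id; _∘_; case_of_; _⇔_; mk⇔; Equivalence)
open import Level using (0ℓ)
open import Relation.Binary.PropositionalEquality
  using (_≡_; _≢_; refl; sym; trans; cong; cong₂; subst)
open import Relation.Nullary using (¬_; yes; no; contradiction)
open import Relation.Nullary.Decidable using (does-⇔; dec-true)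
open import Relation.Unary using (Pred; Decidable)

private
  variable
    N : ℕ

x∈p─q⇒x∉q : ∀ {x} (p q : Subset N) → x ∈ p ─ q → x ∉ q
x∈p─q⇒x∉q (inside ∷ p) (outside ∷ q) Vec.here       ()
x∈p─q⇒x∉q (_ ∷ p) (outside ∷ q) (Vec.there x∈) (Vec.there x∈q) = x∈p─q⇒x∉q p q x∈ x∈q
x∈p─q⇒x∉q (_ ∷ p) (inside ∷ q)  (Vec.there x∈) (Vec.there x∈q) = x∈p─q⇒x∉q p q x∈ x∈q

x∉p-x : ∀ (p : Subset N) x → x ∉ p ∖ x
x∉p-x p x x∈ = x∈p─q⇒x∉q p _ x∈ (x∈⁅x⁆ x)

∣p─q∣+∣q∣≡∣p∣ : ∀ (p q : Subset N) → q ⊆ p → ∣ p ─ q ∣ ℕ.+ ∣ q ∣ ≡ ∣ p ∣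
∣p─q∣+∣q∣≡∣p∣ []            []            q⊆p = refl
∣p─q∣+∣q∣≡∣p∣ (outside ∷ p) (outside ∷ q) q⊆p = ∣p─q∣+∣q∣≡∣p∣ p q (drop-∷-⊆ q⊆p)
∣p─q∣+∣q∣≡∣p∣ (inside ∷ p)  (outside ∷ q) q⊆p = cong suc (∣p─q∣+∣q∣≡∣p∣ p q (drop-∷-⊆ q⊆p))
∣p─q∣+∣q∣≡∣p∣ (inside ∷ p)  (inside ∷ q)  q⊆p =
  trans (ℕ.+-suc _ _) (cong suc (∣p─q∣+∣q∣≡∣p∣ p q (drop-∷-⊆ q⊆p)))
∣p─q∣+∣q∣≡∣p∣ (outside ∷ p) (inside ∷ q)  q⊆p with () ← q⊆p Vec.here

∈-subsets : ∀ (p : Subset N) → p ∈ˡ subsets N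
∈-subsets []            = here refl
∈-subsets (outside ∷ p) = ∈-++⁺ˡ (∈-map⁺ (outside ∷_) (∈-subsets p))
∈-subsets (inside ∷ p)  = ∈-++⁺ʳ _ (∈-map⁺ (inside ∷_) (∈-subsets p))

-- Common form of `γst` and `st-γst`: the least size of a subset satisfying `P`, with default value
-- `k`.
module _ {P : Pred (Subset N) 0ℓ} (P? : Decidable P) (k : ℕ) where

  minSize : ℕ
  minSize = min k (map ∣_∣ (filter P? (subsets N)))

  minSize≤∣p∣ : ∀ {p} → P p → minSize ℕ.≤ ∣ p ∣
  minSize≤∣p∣ {p} Pp = min≤v⁺ k _
    (inj₂ (lose (∈-map⁺ ∣_∣ (∈-filter⁺ P? (∈-subsets p) Pp)) ℕ.≤-refl))

  -- The minimum may be the default `k` rather than a listed size; `p` is the witness in that case.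
  minSize-attained : ∀ {p} → P p → k ≡ ∣ p ∣ → ∃ λ q → P q × minSize ≡ ∣ q ∣
  minSize-attained {p} Pp k≡∣p∣ with argmin-sel id k (map ∣_∣ (filter P? (subsets N)))
  ... | inj₁ ≡k = p , Pp , trans ≡k k≡∣p∣
  ... | inj₂ ∈sizes with q , q∈ , ≡∣q∣ ← ∈-map⁻ ∣_∣ ∈sizes
                    with _ , Pq ← ∈-filter⁻ P? {xs = subsets N} q∈ = q , Pq , ≡∣q∣

V-strongDominating : (G : Graph N) → StrongDominating G (V G)
V-strongDominating G = id , λ v v∈V v∉V → contradiction v∈V v∉V

γst≤ : (G : Graph N) {D : Subset N} → StrongDominating G D → γst G ℕ.≤ ∣ D ∣
γst≤ G = minSize≤∣p∣ (strongDominating? G) (order G)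

γst-attained : (G : Graph N) → ∃ λ D → StrongDominating G D × γst G ≡ ∣ D ∣
γst-attained G = minSize-attained (strongDominating? G) (order G) (V-strongDominating G) refl

st-γst≤order : (G : Graph N) → st-γst G ℕ.≤ order G
st-γst≤order G = min≤⊤ _ (map ∣_∣ (filter (changes-γst? G) (subsets _)))

st-γst≤ : (G : Graph N) {S : Subset N} → Changes-γst G S → st-γst G ℕ.≤ ∣ S ∣
st-γst≤ G = minSize≤∣p∣ (changes-γst? G) (order G)

∈-neighbours⁺ : (G : Graph N) {v u : Fin N} → Adj G v u → u ∈ neighbours G v
∈-neighbours⁺ G {v} {u} vu =
  lookup⇒[]= u _ (trans (lookup∘tabulate _ u) (dec-true (Adj? G v u) vu))

-- Degrees are counted over the ambient `Fin N`, so agreement of the adjacencies suffices even when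
-- the vertex sets differ.
deg-cong : (G H : Graph N) → (∀ {u w} → Adj G u w ⇔ Adj H u w) → ∀ u → deg G u ≡ deg H u
deg-cong G H G⇔H u = cong ∣_∣ (tabulate-cong λ w → does-⇔ G⇔H (Adj? G u w) (Adj? H u w))

-- Here `H` is `G` with an isolated vertex `v` added. Nothing can dominate `v`, so a minimum strong
-- dominating set `D` of `H` contains it. Nor does `v` dominate any other vertex, and degrees agree,
-- so `D ∖ v` still works for `G`.
γst-isolated : (G H : Graph N) (v : Fin N) →
               v ∉ V G → v ∈ V H → (∀ {u} → u ∈ V H → u ≢ v → u ∈ V G) →
               V G ⊆ V H → (∀ {u w} → Adj G u w ⇔ Adj H u w) →
               γst G ℕ.< γst H
γst-isolated G H v v∉G v∈H H-v⊆G G⊆H G⇔H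
  with D , (D⊆H , D-dom) , γ≡ ← γst-attained H
  = subst (γst G ℕ.<_) (sym γ≡) (ℕ.≤-<-trans (γst≤ G (D-v⊆G , D-v-dom)) (x∈p⇒∣p-x∣<∣p∣ v∈D))
  where
  v∈D : v ∈ D
  v∈D with v ∈? D
  ... | yes v∈D = v∈D
  ... | no  v∉D with _ , _ , vu , _ ← D-dom v v∈H v∉D
                = contradiction (Adj⇒∈V G (Equivalence.from G⇔H vu)) v∉G

  D-v⊆G : D ∖ v ⊆ V G
  D-v⊆G u∈ = H-v⊆G (D⊆H (p─q⊆p D _ u∈)) λ { refl → x∉p-x D v u∈ }

  D-v-dom : ∀ w → w ∈ V G → w ∉ D ∖ v →
            ∃ λ u → u ∈ D ∖ v × Adj G w u × deg G w ℕ.≤ deg G u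
  D-v-dom w w∈G w∉ with u , u∈D , wu , dw≤du ← D-dom w (G⊆H w∈G)
                          (λ w∈D → w∉ (x∈p∧x≢y⇒x∈p-y w∈D λ { refl → v∉G w∈G }))
    = u
    , x∈p∧x≢y⇒x∈p-y u∈D (λ { refl → v∉G (Adj⇒∈V G (symm G (Equivalence.from G⇔H wu))) })
    , Equivalence.from G⇔H wu
    , subst id (cong₂ ℕ._≤_ (sym (deg-cong G H G⇔H w)) (sym (deg-cong G H G⇔H u))) dw≤du

st-γst-complement : (G : Graph N) {v : Fin N} → v ∈ V G →
                    st-γst (complement G) ℕ.≤ ∣ V G ─ neighbours G v ∣
st-γst-complement G {v} v∈V = case γst (delete H S) ℕ.≟ γst H of λ where
    (no changes) → st-γst≤ H (S⊆V , changes)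
    -- If deleting `S` preserves `γst H`, then `γst<` says that deleting `S ∖ v` gives a value
    -- strictly above `γst H`.
    (yes same)   → ℕ.≤-trans
      (st-γst≤ H (S⊆V ∘ S-v⊆S , ℕ.>⇒≢ (subst (ℕ._< γst (delete H (S ∖ v))) same γst<)))
      (p⊆q⇒∣p∣≤∣q∣ S-v⊆S)
  where
  H = complement G
  S = V G ─ neighbours G v

  S⊆V : S ⊆ V G
  S⊆V = p─q⊆p (V G) _

  S-v⊆S : S ∖ v ⊆ S
  S-v⊆S = p─q⊆p S _

  v∈S : v ∈ S
  v∈S = x∈p∧x∉q⇒x∈p─q v∈V (irrefl G refl ∘ ∈-neighbours⁻ G)

  V─S⊆V─S-v : V G ─ S ⊆ V G ─ (S ∖ v)
  V─S⊆V─S-v x∈ = x∈p∧x∉q⇒x∈p─q (p─q⊆p (V G) S x∈) (x∈p─q⇒x∉q (V G) S x∈ ∘ S-v⊆S)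

  shrink : ∀ {x} → x ∈ V G ─ (S ∖ v) → x ≢ v → x ∈ V G ─ S
  shrink x∈ x≢v = x∈p∧x∉q⇒x∈p─q (p─q⊆p (V G) _ x∈)
    (λ x∈S → x∈p─q⇒x∉q (V G) _ x∈ (x∈p∧x≢y⇒x∈p-y x∈S x≢v))

  -- A neighbour of `v` in `H` differs from `v` and lies in `S`, so it has been deleted with
  -- `S ∖ v`.
  v-isolated : ∀ {x} → x ∈ V G ─ (S ∖ v) → ¬ Adj H v x
  v-isolated x∈ (_ , x∈V , v≢x , ¬vx) = x∈p─q⇒x∉q (V G) S (shrink x∈ (v≢x ∘ sym))
    (x∈p∧x∉q⇒x∈p─q x∈V (¬vx ∘ ∈-neighbours⁻ G))

  γst< : γst (delete H S) ℕ.< γst (delete H (S ∖ v))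
  γst< = γst-isolated (delete H S) (delete H (S ∖ v)) v
    (λ v∈ → x∈p─q⇒x∉q (V G) S v∈ v∈S)
    (x∈p∧x∉q⇒x∈p─q v∈V (x∉p-x S v))
    shrink V─S⊆V─S-v
    (mk⇔ (λ (x∈ , y∈ , xy) → V─S⊆V─S-v x∈ , V─S⊆V─S-v y∈ , xy)
         -- An edge that survives the deletion of `S ∖ v` avoids the isolated `v` at both ends, so
         -- it also survives the deletion of `S`.
         (λ (x∈ , y∈ , xy) → shrink x∈ (λ { refl → v-isolated y∈ xy })
                           , shrink y∈ (λ { refl → v-isolated x∈ (symm H xy) })
                           , xy))

-- Rearranged as `maxDegree G ≤ order G ∸ s`, this follows from the same bound on each single
-- degree.
st-γst-complement≤ : (G : Graph N) → st-γst (complement G) ℕ.≤ order G ∸ maxDegree G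
st-γst-complement≤ G = ℕ.m+n≤o⇒m≤o∸n s (subst (ℕ._≤ order G) (ℕ.+-comm (maxDegree G) s)
  -- Since `s` is at most the order, the subtraction `order G ∸ s` is not truncated and can be
  -- undone.
  (ℕ.m≤o∸n⇒m+n≤o (maxDegree G) (st-γst≤order (complement G))
    (max≤v⁺ ℕ.z≤n (All.map⁺ (All.map deg≤ (All.all-filter (_∈? V G) (allFin _)))))))
  where
  s = st-γst (complement G)

  deg≤ : ∀ {v} → v ∈ V G → deg G v ℕ.≤ order G ∸ s
  deg≤ {v} v∈V = ℕ.m+n≤o⇒m≤o∸n _ (begin
    deg G v ℕ.+ s                            ≤⟨ ℕ.+-monoʳ-≤ (deg G v) (st-γst-complement G v∈V) ⟩
    deg G v ℕ.+ ∣ V G ─ neighbours G v ∣      ≡⟨ ℕ.+-comm (deg G v) _ ⟩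
    ∣ V G ─ neighbours G v ∣ ℕ.+ deg G v      ≡⟨ ∣p─q∣+∣q∣≡∣p∣ (V G) _ (Adj⇒∈V G ∘ symm G ∘ ∈-neighbours⁻ G) ⟩
    order G                                  ∎)
    where open ℕ.≤-Reasoning

-- The final bound with its denominator `m = n ∸ Δ` cleared. With `n = m + d` it comes down to
-- `d ≤ m * d`, which uses `m ≥ 1`.
a*m+n≤[2n+2]*m : ∀ {a m n} .{{_ : NonZero m}} → m ℕ.≤ n → a ℕ.≤ n ℕ.+ m →
                 a ℕ.* m ℕ.+ n ℕ.≤ (2 ℕ.* n ℕ.+ 2) ℕ.* m
a*m+n≤[2n+2]*m {a} {m} {n} m≤n a≤n+m with d , refl ← ℕ.m≤n⇒∃[o]m+o≡n m≤n = begin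
  a ℕ.* m ℕ.+ (m ℕ.+ d)                          ≤⟨ ℕ.+-monoˡ-≤ _ (ℕ.*-monoˡ-≤ m a≤n+m) ⟩
  (m ℕ.+ d ℕ.+ m) ℕ.* m ℕ.+ (m ℕ.+ d)            ≤⟨ ℕ.+-monoʳ-≤ ((m ℕ.+ d ℕ.+ m) ℕ.* m) (ℕ.+-monoʳ-≤ m (ℕ.m≤n*m d m)) ⟩
  (m ℕ.+ d ℕ.+ m) ℕ.* m ℕ.+ (m ℕ.+ m ℕ.* d)      ≤⟨ ℕ.m≤m+n _ m ⟩
  (m ℕ.+ d ℕ.+ m) ℕ.* m ℕ.+ (m ℕ.+ m ℕ.* d) ℕ.+ m ≡⟨ identity m d ⟩
  (2 ℕ.* (m ℕ.+ d) ℕ.+ 2) ℕ.* m                  ∎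
  where
  open ℕ.≤-Reasoning
  identity : ∀ m d → (m ℕ.+ d ℕ.+ m) ℕ.* m ℕ.+ (m ℕ.+ m ℕ.* d) ℕ.+ m ≡ (2 ℕ.* (m ℕ.+ d) ℕ.+ 2) ℕ.* m
  identity = solve-∀

-- The comparison is moved to unnormalised rationals, where the order is cross-multiplication of
-- integers. As `mkℚᵘ` stores the denominator minus one, `m` is split as `suc k`.
a≤b-n/m+c : ∀ a b c n m .{{_ : NonZero m}} → a ℕ.* m ℕ.+ n ℕ.≤ (b ℕ.+ c) ℕ.* m →
            (+ a) / 1 ≤ (+ b) / 1 - (+ n) / m + (+ c) / 1
a≤b-n/m+c a b c n m@(suc k) am+n≤ = ℚ.toℚᵘ-cancel-≤ (begin
  toℚᵘ ((+ a) / 1)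
    ≃⟨ ℚ.toℚᵘ-fromℚᵘ (mkℚᵘ (+ a) 0) ⟩
  mkℚᵘ (+ a) 0
    ≤⟨ *≤* unnormalised ⟩
  mkℚᵘ (+ b) 0 ℚᵘ.- mkℚᵘ (+ n) k ℚᵘ.+ mkℚᵘ (+ c) 0
    ≃⟨ ℚᵘ.+-cong (ℚᵘ.+-cong (ℚ.toℚᵘ-fromℚᵘ (mkℚᵘ (+ b) 0)) (ℚᵘ.-‿cong (ℚ.toℚᵘ-fromℚᵘ (mkℚᵘ (+ n) k))))
                 (ℚ.toℚᵘ-fromℚᵘ (mkℚᵘ (+ c) 0)) ⟨
  toℚᵘ ((+ b) / 1) ℚᵘ.- toℚᵘ ((+ n) / m) ℚᵘ.+ toℚᵘ ((+ c) / 1)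
    ≃⟨ ℚᵘ.+-congˡ _ (ℚᵘ.+-congʳ (toℚᵘ ((+ b) / 1)) (ℚ.toℚᵘ-homo‿- ((+ n) / m))) ⟨
  toℚᵘ ((+ b) / 1) ℚᵘ.+ toℚᵘ (ℚ.- ((+ n) / m)) ℚᵘ.+ toℚᵘ ((+ c) / 1)
    ≃⟨ ℚᵘ.+-congˡ _ (ℚ.toℚᵘ-homo-+ ((+ b) / 1) _) ⟨
  toℚᵘ ((+ b) / 1 - (+ n) / m) ℚᵘ.+ toℚᵘ ((+ c) / 1)
    ≃⟨ ℚ.toℚᵘ-homo-+ ((+ b) / 1 - (+ n) / m) _ ⟨
  toℚᵘ ((+ b) / 1 - (+ n) / m + (+ c) / 1)
    ∎)
  where
  open ℚᵘ.≤-Reasoning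

  -- `lhs` and `rhs` rewrite the two cross products so that they are the sides of `am+n≤ℤ` with `n`
  -- subtracted.
  lhs : ∀ a n m → a ℤ.* (+ 1 ℤ.* m ℤ.* + 1) ≡ a ℤ.* m ℤ.+ n ℤ.- n
  lhs = ℤ-RingSolver.solve-∀

  rhs : ∀ b c n m → (b ℤ.+ c) ℤ.* m ℤ.- n ≡
        ((b ℤ.* m ℤ.+ (ℤ.- n) ℤ.* + 1) ℤ.* + 1 ℤ.+ c ℤ.* (+ 1 ℤ.* m)) ℤ.* + 1
  rhs = ℤ-RingSolver.solve-∀

  am+n≤ℤ : (+ a) ℤ.* (+ m) ℤ.+ (+ n) ℤ.≤ ((+ b) ℤ.+ (+ c)) ℤ.* (+ m)
  am+n≤ℤ rewrite sym (ℤ.pos-* a m) | sym (ℤ.pos-* (b ℕ.+ c) m) = ℤ.+≤+ am+n≤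

  unnormalised : (+ a) ℤ.* ℚᵘ.↧ (mkℚᵘ (+ b) 0 ℚᵘ.- mkℚᵘ (+ n) k ℚᵘ.+ mkℚᵘ (+ c) 0) ℤ.≤
                 ℚᵘ.↥ (mkℚᵘ (+ b) 0 ℚᵘ.- mkℚᵘ (+ n) k ℚᵘ.+ mkℚᵘ (+ c) 0) ℤ.* + 1
  unnormalised = subst id (cong₂ ℤ._≤_ (sym (lhs (+ a) (+ n) (+ m))) (rhs (+ b) (+ c) (+ n) (+ m)))
    (ℤ.+-monoˡ-≤ (ℤ.- (+ n)) am+n≤ℤ)

theorem3p5 : ∀ {N : ℕ} (G : Graph N) .{{_ : NonZero (order G)}} →
    let n = order G
        Δ = maxDegree G
        instance n∸Δ≢0 = order∸maxDegree≢0 G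
    in (+ (st-γst G ℕ.+ st-γst (complement G))) / 1
         ≤ (+ (2 ℕ.* n)) / 1 - (+ n) / (n ∸ Δ) + (+ 2) / 1
theorem3p5 G = a≤b-n/m+c (st-γst G ℕ.+ st-γst (complement G)) (2 ℕ.* n) 2 n (n ∸ Δ)
  {{order∸maxDegree≢0 G}}
  (a*m+n≤[2n+2]*m {{order∸maxDegree≢0 G}} (ℕ.m∸n≤m n Δ)
    (ℕ.+-mono-≤ (st-γst≤order G) (st-γst-complement≤ G)))
  where
  n = order G
  Δ = maxDegree G
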